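{- A connected graph $G$ contains none of $P_5$, $C_4$, $C_5$, the claw, the bull as an induced subgraph if and only if $G$ is a co-chain graph.
   Context: All graphs are finite and simple. A graph $G$ is a co-chain graph if its vertex set can be partitioned into two cliques $X$ and $Y$ such that the vertices of $X$ can be ordered $x_1,\dots,x_{|X|}$ with $N[x_i]\subseteq N[x_j]$ for all $1\le i<j\le |X|$ (closed neighborhoods). $P_n$, $C_n$ denote the path and cycle on $n$ vertices; the claw is $K_{1,3}$; the bull is the $5$-vertex graph consisting of a triangle with two pendant edges attached at two distinct triangle vertices. -}

module Defs where

open import Level using (0ℓ)
open import Data.Nat as ℕ using (ℕ; suc; _+_; NonZero)
open import Data.Nat.DivMod using (_%_)
open import Data.Fin using (Fin; toℕ; _<_; _≟_; #_)
open import Data.Fin.Subset using (Subset; _∈_; _∉_; ∣_∣)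
open import Data.List using (List; []; _∷_)
import Data.List.Membership.Propositional as ListMem
import Data.List.Membership.DecPropositional as DecListMem
open import Data.Product using (_×_; _,_; ∃; Σ-syntax)
open import Data.Product.Properties using (≡-dec)
open import Data.Sum using (_⊎_; swap)
open import Function.Bundles using (_⇔_)
open import Function.Definitions using (Injective)
open import Relation.Binary.Core using (Rel)
open import Relation.Binary.Definitions using (Symmetric; Irreflexive; Decidable)
open import Relation.Binary.Construct.Closure.ReflexiveTransitive using (Star)
open import Relation.Binary.PropositionalEquality using (_≡_; _≢_; sym)
open import Relation.Nullary using (¬_; ¬?; _×-dec_; _⊎-dec_)
open import Relation.Unary using (Pred; _⊆_)

record Graph (n : ℕ) : Set₁ where
  field
    Adj        : Rel (Fin n) 0ℓ
    adj-sym    : Symmetric Adj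
    adj-irrefl : Irreflexive _≡_ Adj
    adj?       : Decidable Adj

open Graph public

Connected : ∀ {n} → Graph n → Set
Connected {n} G = (u v : Fin n) → Star (Adj G) u v

closedNbhd : ∀ {n} → Graph n → Fin n → Pred (Fin n) 0ℓ
closedNbhd G v u = u ≡ v ⊎ Adj G v u

IsClique : ∀ {n} → Graph n → Subset n → Set
IsClique G S = ∀ {u v} → u ∈ S → v ∈ S → u ≢ v → Adj G u v

record IsCoChain {n : ℕ} (G : Graph n) : Set where
  field
    X Y      : Subset n
    cover    : ∀ v → v ∈ X ⊎ v ∈ Y
    disjoint : ∀ {v} → v ∈ X → v ∉ Y
    clique-X : IsClique G X
    clique-Y : IsClique G Y
    x        : Fin ∣ X ∣ → Fin n
    x∈X      : ∀ i → x i ∈ X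
    x-inj    : Injective _≡_ _≡_ x
    x-onto   : ∀ {v} → v ∈ X → ∃ λ i → x i ≡ v
    nested   : ∀ {i j} → i < j → closedNbhd G (x i) ⊆ closedNbhd G (x j)

_IsInducedIn_ : ∀ {m n} → Graph m → Graph n → Set
_IsInducedIn_ {m} {n} H G =
  Σ[ f ∈ (Fin m → Fin n) ]
    (Injective _≡_ _≡_ f × (∀ i j → Adj H i j ⇔ Adj G (f i) (f j)))

symmetrise : ∀ {n} {R : Rel (Fin n) 0ℓ} → Decidable R → Graph n
symmetrise {R = R} R? = record
  { Adj        = λ i j → i ≢ j × (R i j ⊎ R j i)
  ; adj-sym    = λ (i≢j , r) → (λ j≡i → i≢j (sym j≡i)) , swap r
  ; adj-irrefl = λ i≡j (i≢j , _) → i≢j i≡j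
  ; adj?       = λ i j → ¬? (i ≟ j) ×-dec (R? i j ⊎-dec R? j i)
  }

P : (n : ℕ) → Graph n
P n = symmetrise (λ i j → suc (toℕ i) ℕ.≟ toℕ j)

-- The cycle on n vertices for n ≥ 3 (for n = 1, 2 this is K₁, K₂).
C : (n : ℕ) .{{_ : NonZero n}} → Graph n
C n = symmetrise (λ i j → suc (toℕ i) % n ℕ.≟ toℕ j)

-- The parts are {0 , … , m - 1} and {m , … , m + n - 1}.
K : (m n : ℕ) → Graph (m + n)
K m n = symmetrise (λ i j → (toℕ i ℕ.<? m) ×-dec (m ℕ.≤? toℕ j))

claw : Graph 4
claw = K 1 3

-- Triangle 0 1 2, with pendant vertices 3 at 0 and 4 at 1.
bullEdges : List (Fin 5 × Fin 5)
bullEdges = (# 0 , # 1) ∷ (# 1 , # 2) ∷ (# 0 , # 2) ∷ (# 0 , # 3) ∷ (# 1 , # 4) ∷ []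

bull : Graph 5
bull = symmetrise {R = λ i j → (i , j) ListMem.∈ bullEdges} (λ i j → (i , j) ∈? bullEdges)
  where open DecListMem (≡-dec _≟_ _≟_) using (_∈?_)

{-# OPTIONS --safe #-}
-- If a, b, c are pairwise non-adjacent, then P₅-freeness puts b and c at distance 2 or 3 from a,
-- and shortest paths from a to b and c together induce one of the five graphs; so a connected graph
-- without them has no independent triple.  Hence the non-neighbours of any vertex a form a clique,
-- and if a has minimum degree its closed neighbourhood is a clique too: non-adjacent neighbours u, v
-- of a would each have a neighbour outside N[a] by minimality, giving an induced C₄ or C₅.  On N[a]
-- closed neighbourhoods are nested because C₄ is excluded, so sorting N[a] by degree gives the chain.
-- Conversely two cliques leave no room for an independent triple or C₅, and nestedness excludes C₄.
module Submission where

open import Level using (0ℓ)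
open import Data.Nat as ℕ using (ℕ; zero; suc; s≤s⁻¹)
import Data.Nat.Properties as ℕ
open import Data.Bool using (if_then_else_)
open import Data.Fin using (Fin; zero; suc; _<_; _≟_; #_)
open import Data.Fin.Properties using (<-cmp; any?)
open import Data.Fin.Subset using (Subset; inside; outside; _∈_; ∣_∣; ∁)
open import Data.Fin.Subset.Properties using (_∈?_; x∈p⇒x∉∁p; x∈∁p⇒x∉p; x∉p⇒x∈∁p; p⊂q⇒∣p∣<∣q∣; drop-there)
open import Data.List as List using (List; []; _∷_; length; allFin)
open import Data.List.Properties using (length-map)
import Data.List.Extrema ℕ.≤-totalOrder as Extrema
import Data.List.Membership.Propositional as List
open import Data.List.Membership.Propositional.Properties using (∈-map⁺; ∈-map⁻; ∈-lookup; ∈-allFin)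
open import Data.List.Relation.Binary.Permutation.Propositional using (↭-sym; ↭⇒↭ₛ)
open import Data.List.Relation.Binary.Permutation.Propositional.Properties using (∈-resp-↭; ↭-length)
import Data.List.Relation.Binary.Permutation.Setoid.Properties as Permutationₛ
open import Data.List.Relation.Unary.All as All using ([]; _∷_)
import Data.List.Relation.Unary.All.Properties as All
open import Data.List.Relation.Unary.AllPairs using ([]; _∷_)
open import Data.List.Relation.Unary.Any using (here; there; index)
open import Data.List.Relation.Unary.Any.Properties using (lookup-index)
open import Data.List.Relation.Unary.Unique.Propositional using (Unique)
import Data.List.Relation.Unary.Unique.Propositional.Properties as Unique
open import Data.List.Relation.Unary.Sorted.TotalOrder.Properties using (lookup-mono-≤)
import Data.List.Sort as Sort
open import Data.Product using (_×_; _,_; ∃; proj₁; proj₂)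
open import Data.Sum using (_⊎_; inj₁; inj₂; [_,_]′)
open import Data.Unit using (⊤; tt)
open import Data.Empty using (⊥)
open import Data.Vec as Vec using ([]; _∷_; lookup; tabulate)
open import Data.Vec.Properties using (lookup∘tabulate; lookup⇒[]=; []=⇒lookup)
open import Function using (_∘_; _on_)
open import Function.Bundles using (_⇔_; mk⇔; Equivalence)
open import Function.Definitions using (Injective)
open import Relation.Binary.Bundles using (DecTotalOrder)
import Relation.Binary.Construct.On as On
open import Relation.Binary.Construct.Closure.ReflexiveTransitive using (Star; ε; _◅_)
open import Relation.Binary.Core using (Rel)
open import Relation.Binary.Definitions using (tri<; tri≈; tri>)
open import Relation.Binary.PropositionalEquality using (_≡_; _≢_; refl; sym; trans; cong; setoid)
open import Relation.Nullary using (¬_; ¬?; Dec; yes; no; does; contradiction)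
open import Relation.Nullary.Decidable using (True; False; toWitness; toWitnessFalse; _×-dec_; _⊎-dec_; decidable-stable; dec-true)
open import Relation.Unary using (Pred; Decidable; _⊆_)
open import Defs

-- Quantification over finite sets and sorted enumeration of subsets

ForAll : ∀ m → (Fin m → Set) → Set
ForAll zero    Q = ⊤
ForAll (suc m) Q = Q zero × ForAll m (Q ∘ suc)

-- For a numeral `m` this computes to nested tuples ending in `tt`, so the table of a small graph
-- can be given entry by entry. Only `i < j` is recorded, which is enough for symmetric relations.
ForAllPairs : ∀ m → Rel (Fin m) 0ℓ → Set
ForAllPairs zero    R = ⊤
ForAllPairs (suc m) R = ForAll m (R zero ∘ suc) × ForAllPairs m (R on suc)

∀-lookup : ∀ {m Q} → ForAll m Q → ∀ i → Q i
∀-lookup (q , qs) zero    = q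
∀-lookup (q , qs) (suc i) = ∀-lookup qs i

∀-lookup-< : ∀ {m R} → ForAllPairs m R → ∀ {i j} → i < j → R i j
∀-lookup-< (r , rs) {zero}  {suc j} i<j = ∀-lookup r j
∀-lookup-< (r , rs) {suc i} {suc j} i<j = ∀-lookup-< rs (s≤s⁻¹ i<j)

fromDec : ∀ {n} {Q : Pred (Fin n) 0ℓ} → Decidable Q → Subset n
fromDec Q? = tabulate (does ∘ Q?)

module _ {n} {Q : Pred (Fin n) 0ℓ} (Q? : Decidable Q) where

  ∈-fromDec⁺ : ∀ {v} → Q v → v ∈ fromDec Q?
  ∈-fromDec⁺ {v} q = lookup⇒[]= v _ (trans (lookup∘tabulate _ v) (dec-true (Q? v) q))

  ∈-fromDec⁻ : ∀ {v} → v ∈ fromDec Q? → Q v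
  ∈-fromDec⁻ {v} v∈ with Q? v | trans (sym (lookup∘tabulate (does ∘ Q?) v)) ([]=⇒lookup v∈)
  ... | yes q | _ = q
  ... | no _  | ()

elements : ∀ {n} → Subset n → List (Fin n)
elements []            = []
elements (inside  ∷ p) = zero ∷ List.map suc (elements p)
elements (outside ∷ p) = List.map suc (elements p)

length-elements : ∀ {n} (p : Subset n) → length (elements p) ≡ ∣ p ∣
length-elements []            = refl
length-elements (inside  ∷ p) = cong suc (trans (length-map suc (elements p)) (length-elements p))
length-elements (outside ∷ p) = trans (length-map suc (elements p)) (length-elements p)

∈-elements⁺ : ∀ {n} {p : Subset n} {v} → v ∈ p → v List.∈ elements p
∈-elements⁺ {p = inside  ∷ p} {zero}  v∈p = here refl
∈-elements⁺ {p = inside  ∷ p} {suc v} v∈p = there (∈-map⁺ suc (∈-elements⁺ (drop-there v∈p)))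
∈-elements⁺ {p = outside ∷ p} {suc v} v∈p = ∈-map⁺ suc (∈-elements⁺ (drop-there v∈p))

∈-elements⁻ : ∀ {n} (p : Subset n) {v} → v List.∈ elements p → v ∈ p
∈-elements⁻ (inside  ∷ p) (here refl) = Vec.here
∈-elements⁻ (inside  ∷ p) (there v∈) with ∈-map⁻ suc v∈
... | _ , u∈ , refl = Vec.there (∈-elements⁻ p u∈)
∈-elements⁻ (outside ∷ p) v∈ with ∈-map⁻ suc v∈
... | _ , u∈ , refl = Vec.there (∈-elements⁻ p u∈)

elements-unique : ∀ {n} (p : Subset n) → Unique (elements p)
elements-unique []            = []
elements-unique (inside  ∷ p) =
  All.map⁺ (All.universal (λ _ ()) (elements p)) ∷ Unique.map⁺ (λ { refl → refl }) (elements-unique p)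
elements-unique (outside ∷ p) = Unique.map⁺ (λ { refl → refl }) (elements-unique p)

lookup-injective : ∀ {A : Set} {xs : List A} → Unique xs → Injective _≡_ _≡_ (List.lookup xs)
lookup-injective (_ ∷ _)  {zero}  {zero}  _  = refl
lookup-injective (x∉ ∷ _) {zero}  {suc j} eq = contradiction eq (All.lookup x∉ (∈-lookup j))
lookup-injective (x∉ ∷ _) {suc i} {zero}  eq = contradiction (sym eq) (All.lookup x∉ (∈-lookup i))
lookup-injective (_ ∷ u)  {suc i} {suc j} eq = cong suc (lookup-injective u eq)

module _ {n} (key : Fin n → ℕ) where

  keyOrder : DecTotalOrder 0ℓ 0ℓ 0ℓ
  keyOrder = On.decTotalOrder ℕ.≤-decTotalOrder key

  open Sort keyOrder using (sort; sort-↭; sort-↗)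

  sortedEnumeration : (p : Subset n) → ∃ λ (x : Fin ∣ p ∣ → Fin n) →
    (∀ i → x i ∈ p) × Injective _≡_ _≡_ x × (∀ {v} → v ∈ p → ∃ λ i → x i ≡ v) ×
    (∀ {i j} → i < j → key (x i) ℕ.≤ key (x j))
  sortedEnumeration p = enumerate (trans (↭-length (sort-↭ (elements p))) (length-elements p))
    where
    xs = sort (elements p)

    -- Replacing `∣ p ∣` by a variable `k` lets the length equation be matched with `refl`, which
    -- avoids transport along it.
    enumerate : ∀ {k} → length xs ≡ k → ∃ λ (x : Fin k → Fin n) →
      (∀ i → x i ∈ p) × Injective _≡_ _≡_ x × (∀ {v} → v ∈ p → ∃ λ i → x i ≡ v) ×
      (∀ {i j} → i < j → key (x i) ℕ.≤ key (x j))
    enumerate refl =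
      List.lookup xs ,
      (λ i → ∈-elements⁻ p (∈-resp-↭ (sort-↭ (elements p)) (∈-lookup i))) ,
      lookup-injective (Permutationₛ.Unique-resp-↭ (setoid (Fin n))
        (↭⇒↭ₛ (↭-sym (sort-↭ (elements p)))) (elements-unique p)) ,
      (λ v∈p → let v∈xs = ∈-resp-↭ (↭-sym (sort-↭ (elements p))) (∈-elements⁺ v∈p)
               in index v∈xs , sym (lookup-index v∈xs)) ,
      (λ i<j → lookup-mono-≤ (DecTotalOrder.totalOrder keyOrder) (sort-↗ (elements p)) (ℕ.<⇒≤ i<j))

-- Adjacent, equal and non-adjacent pairs of vertices

module _ {n} (G : Graph n) where

  infix 4 _~_ _∥_

  _~_ _∥_ : Rel (Fin n) 0ℓ
  u ~ v = Adj G u v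
  u ∥ v = u ≢ v × ¬ u ~ v

  ~-sym : ∀ {u v} → u ~ v → v ~ u
  ~-sym = adj-sym G

  ∥-sym : ∀ {u v} → u ∥ v → v ∥ u
  ∥-sym (u≢v , u≁v) = u≢v ∘ sym , u≁v ∘ ~-sym

  ~⇒≢ : ∀ {u v} → u ~ v → u ≢ v
  ~⇒≢ u~v u≡v = adj-irrefl G u≡v u~v

  data Comparison (u v : Fin n) : Set where
    equal    : u ≡ v → Comparison u v
    adjacent : u ~ v → Comparison u v
    apart    : u ∥ v → Comparison u v

  compare : ∀ u v → Comparison u v
  compare u v with u ≟ v | adj? G u v
  ... | yes u≡v | _       = equal u≡v
  ... | no  _   | yes u~v = adjacent u~v
  ... | no  u≢v | no  u≁v = apart (u≢v , u≁v)

  -- Induced subgraphs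

  -- Branching on `does` makes the type reduce to `u ~ v` or `u ∥ v` as soon as the pattern graph
  -- and the two indices are concrete.
  Matches : ∀ {A : Set} → Dec A → Rel (Fin n) 0ℓ
  Matches d u v = if does d then u ~ v else u ∥ v

  module _ {m} (H : Graph m) where

    -- Both `~` and `∥` force distinct ends, so injectivity of `f` comes out of the table of pairs
    -- and is not asked for separately.
    fromMatches : (f : Fin m → Fin n) → ForAllPairs m (λ i j → Matches (adj? H i j) (f i) (f j)) → H IsInducedIn G
    fromMatches f matches = f , injective , λ i j → mk⇔ (to i j) (from i j)
      where
      Same : Rel (Fin m) 0ℓ
      Same i j = Adj H i j × f i ~ f j ⊎ ¬ Adj H i j × f i ∥ f j

      same-< : ∀ {i j} → i < j → Same i j
      same-< {i} {j} i<j with adj? H i j | ∀-lookup-< matches i<j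
      ... | yes a | e = inj₁ (a , e)
      ... | no ¬a | e = inj₂ (¬a , e)

      same : ∀ i j → i ≢ j → Same i j
      same i j i≢j with <-cmp i j
      ... | tri< i<j _ _ = same-< i<j
      ... | tri≈ _ i≡j _ = contradiction i≡j i≢j
      ... | tri> _ _ j<i with same-< j<i
      ...   | inj₁ (a , e)  = inj₁ (adj-sym H a , ~-sym e)
      ...   | inj₂ (¬a , e) = inj₂ (¬a ∘ adj-sym H , ∥-sym e)

      injective : Injective _≡_ _≡_ f
      injective {i} {j} eq = decidable-stable (i ≟ j) λ i≢j →
        [ (λ (_ , e) → ~⇒≢ e eq) , (λ (_ , (ne , _)) → ne eq) ]′ (same i j i≢j)

      to : ∀ i j → Adj H i j → f i ~ f j
      to i j a with same i j (λ i≡j → adj-irrefl H i≡j a)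
      ... | inj₁ (_ , e)  = e
      ... | inj₂ (¬a , _) = contradiction a ¬a

      from : ∀ i j → f i ~ f j → Adj H i j
      from i j e with same i j (λ i≡j → ~⇒≢ e (cong f i≡j))
      ... | inj₁ (a , _)        = a
      ... | inj₂ (_ , (_ , ne)) = contradiction e ne

    -- For a concrete `H` the implicit argument is found by evaluating `adj?`; the same holds for
    -- those of `nonEdge`.
    edge : (h : H IsInducedIn G) → ∀ i j {_ : True (adj? H i j)} → proj₁ h i ~ proj₁ h j
    edge (_ , _ , f-adj) i j {a} = Equivalence.to (f-adj i j) (toWitness a)

    nonEdge : (h : H IsInducedIn G) → ∀ i j {_ : False (i ≟ j)} {_ : False (adj? H i j)} →
      proj₁ h i ∥ proj₁ h j
    nonEdge (_ , f-inj , f-adj) i j {i≢j} {¬a} =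
      (λ eq → toWitnessFalse i≢j (f-inj eq)) , toWitnessFalse ¬a ∘ Equivalence.from (f-adj i j)

  module _ {a b c d : Fin n} where

    mkClaw : a ~ b → a ~ c → a ~ d → b ∥ c → b ∥ d → c ∥ d → claw IsInducedIn G
    mkClaw ab ac ad bc bd cd = fromMatches claw (lookup (a ∷ b ∷ c ∷ d ∷ []))
      ((ab , ac , ad , tt) , (bc , bd , tt) , (cd , tt) , tt , tt)

    mkC₄ : a ~ b → b ~ c → c ~ d → d ~ a → a ∥ c → b ∥ d → C 4 IsInducedIn G
    mkC₄ ab bc cd da ac bd = fromMatches (C 4) (lookup (a ∷ b ∷ c ∷ d ∷ []))
      -- Each row pairs one vertex with the later ones, so the closing edge of the cycle belongs to
      -- the first row and is reversed.
      ((ab , ac , ~-sym da , tt) , (bc , bd , tt) , (cd , tt) , tt , tt)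

    module _ {e : Fin n} where

      mkP₅ : a ~ b → b ~ c → c ~ d → d ~ e →
        a ∥ c → a ∥ d → a ∥ e → b ∥ d → b ∥ e → c ∥ e → P 5 IsInducedIn G
      mkP₅ ab bc cd de ac ad ae bd be ce = fromMatches (P 5) (lookup (a ∷ b ∷ c ∷ d ∷ e ∷ []))
        ((ab , ac , ad , ae , tt) , (bc , bd , be , tt) , (cd , ce , tt) , (de , tt) , tt , tt)

      mkC₅ : a ~ b → b ~ c → c ~ d → d ~ e → e ~ a →
        a ∥ c → a ∥ d → b ∥ d → b ∥ e → c ∥ e → C 5 IsInducedIn G
      mkC₅ ab bc cd de ea ac ad bd be ce = fromMatches (C 5) (lookup (a ∷ b ∷ c ∷ d ∷ e ∷ []))
        ((ab , ac , ad , ~-sym ea , tt) , (bc , bd , be , tt) , (cd , ce , tt) , (de , tt) , tt , tt)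

      mkBull : a ~ b → b ~ c → a ~ c → a ~ d → b ~ e →
        a ∥ e → b ∥ d → c ∥ d → c ∥ e → d ∥ e → bull IsInducedIn G
      mkBull ab bc ac ad be ae bd cd ce de = fromMatches bull (lookup (a ∷ b ∷ c ∷ d ∷ e ∷ []))
        ((ab , ac , ad , ae , tt) , (bc , bd , be , tt) , (cd , ce , tt) , (de , tt) , tt , tt)

  -- Independent triples

  -- The constructors carry induced paths of length at most three. The path in `three` need not be
  -- shortest: another path of length two may reach the same vertex.
  data Near (a : Fin n) : Fin n → Set where
    self  : Near a a
    one   : ∀ {v} → a ~ v → Near a v
    two   : ∀ {p v} → a ~ p → p ~ v → a ∥ v → Near a v
    three : ∀ {p q v} → a ~ p → p ~ q → q ~ v → a ∥ q → a ∥ v → p ∥ v → Near a v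

  NoIndependentTriple : Set
  NoIndependentTriple = ∀ {a b c} → a ∥ b → a ∥ c → b ∥ c → ⊥

  module _ (noP₅ : ¬ P 5 IsInducedIn G) where

    -- Append `w` to the path and cut short at the earliest path vertex equal or adjacent to `w`.
    -- The path outgrows length three only if no shortcut exists, and then it is an induced P₅.
    near-step : ∀ {a v w} → Near a v → v ~ w → Near a w
    near-step {a} {v} {w} near v~w with compare a w
    ... | equal refl   = self
    ... | adjacent a~w = one a~w
    ... | apart a∥w    = far near
      where
      far : Near a v → Near a w
      far self = one v~w
      far (one a~v) = two a~v v~w a∥w
      far (two {p} a~p p~v a∥v) with compare p w
      ... | equal refl   = one a~p
      ... | adjacent p~w = two a~p p~w a∥w
      ... | apart p∥w    = three a~p p~v v~w a∥v a∥w p∥w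
      far (three {p} {q} a~p p~q q~v a∥q a∥v p∥v) with compare p w
      ... | equal refl   = one a~p
      ... | adjacent p~w = two a~p p~w a∥w
      ... | apart p∥w with compare q w
      ...   | equal refl   = two a~p p~q a∥w
      ...   | adjacent q~w = three a~p p~q q~w a∥q a∥w p∥w
      ...   | apart q∥w    = contradiction (mkP₅ a~p p~q q~v v~w a∥q a∥v a∥w p∥v p∥w q∥w) noP₅

    connected⇒near : Connected G → ∀ a v → Near a v
    connected⇒near conn a v = along self (conn a v)
      where
      along : ∀ {u} → Near a u → Star _~_ u v → Near a v
      along near ε          = near
      along near (e ◅ path) = along (near-step near e) path

    module _ (noC₄ : ¬ C 4 IsInducedIn G) (noC₅ : ¬ C 5 IsInducedIn G)
             (noClaw : ¬ claw IsInducedIn G) (noBull : ¬ bull IsInducedIn G) where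

      -- A common neighbour of `a`, `b`, `c` is the centre of a claw. Otherwise `p ~ q` gives a bull
      -- on the triangle `p q a` with pendants `b` and `c`, and `p ∥ q` gives the P₅ `b p a q c`.
      two-two : ∀ {a p q b c} → a ~ p → p ~ b → a ~ q → q ~ c → a ∥ b → a ∥ c → ¬ b ∥ c
      two-two {a} {p} {q} {b} {c} a~p p~b a~q q~c a∥b a∥c b∥c with compare p c | compare q b
      ... | equal refl   | _            = proj₂ a∥c a~p
      ... | adjacent p~c | _            = noClaw (mkClaw (~-sym a~p) p~b p~c a∥b a∥c b∥c)
      ... | apart _      | equal refl   = proj₂ a∥b a~q
      ... | apart _      | adjacent q~b = noClaw (mkClaw (~-sym a~q) q~b q~c a∥b a∥c b∥c)
      ... | apart p∥c    | apart q∥b with compare p q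
      ...   | equal refl   = proj₂ q∥b p~b
      ...   | adjacent p~q = noBull (mkBull p~q (~-sym a~q) (~-sym a~p) p~b q~c p∥c q∥b a∥b a∥c b∥c)
      ...   | apart p∥q    =
        noP₅ (mkP₅ (~-sym p~b) (~-sym a~p) a~q q~c (∥-sym a∥b) (∥-sym q∥b) b∥c p∥q p∥c a∥c)

      -- Once `q ~ c`, the edge `r ~ b` gives a claw at `r`, and `p ~ c` or `r ~ q` a bull whose
      -- triangle contains `q` and `c` and whose pendants are `a` and `b`. With none of these,
      -- `p ~ r` leaves the C₄ `p q c r` and `p ∥ r` the C₅ `a p q c r`.
      three-two : ∀ {a p q r b c} → a ~ p → p ~ q → q ~ b → a ∥ q → p ∥ b →
        a ~ r → r ~ c → a ∥ b → a ∥ c → ¬ b ∥ c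
      three-two {a} {p} {q} {r} {b} {c} a~p p~q q~b a∥q p∥b a~r r~c a∥b a∥c b∥c with compare q c
      ... | equal refl   = proj₂ b∥c (~-sym q~b)
      -- Here `a`, `q`, `c` is itself an independent triple, with both `q` and `c` two steps from
      -- `a`.
      ... | apart q∥c    = two-two a~p p~q a~r r~c a∥q a∥c q∥c
      ... | adjacent q~c with compare r b
      ...   | equal refl   = proj₂ a∥b a~r
      ...   | adjacent r~b = noClaw (mkClaw (~-sym a~r) r~b r~c a∥b a∥c b∥c)
      ...   | apart r∥b    with compare p c | compare r q
      ...     | equal refl   | _            = proj₂ a∥c a~p
      ...     | adjacent p~c | _            =
        noBull (mkBull p~q q~c p~c (~-sym a~p) q~b p∥b (∥-sym a∥q) (∥-sym a∥c) (∥-sym b∥c) a∥b)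
      ...     | apart _      | equal refl   = proj₂ a∥q a~r
      ...     | apart _      | adjacent r~q =
        noBull (mkBull r~q q~c r~c (~-sym a~r) q~b r∥b (∥-sym a∥q) (∥-sym a∥c) (∥-sym b∥c) a∥b)
      ...     | apart p∥c    | apart r∥q    with compare p r
      ...       | equal refl   = proj₂ p∥c r~c
      ...       | adjacent p~r = noC₄ (mkC₄ p~q q~c (~-sym r~c) (~-sym p~r) p∥c (∥-sym r∥q))
      ...       | apart p∥r    =
        noC₅ (mkC₅ a~p p~q q~c (~-sym r~c) (~-sym a~r) a∥q a∥c p∥c p∥r (∥-sym r∥q))

      -- A cross edge `p ~ c` or `r ~ b` shortens one path and reduces to `three-two`; `q ~ c` or
      -- `s ~ b` gives a claw at `q` or `s`. If `q ∥ s`, the triple `a`, `q`, `s` falls to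
      -- `two-two`. If `q ~ s`, then `p ~ s` gives a bull on the triangle `q s p`, and `p ∥ s` the
      -- P₅ `a p q s c`.
      three-three : ∀ {a p q r s b c} → a ~ p → p ~ q → q ~ b → a ∥ q → p ∥ b →
        a ~ r → r ~ s → s ~ c → a ∥ s → r ∥ c → a ∥ b → a ∥ c → ¬ b ∥ c
      three-three {a} {p} {q} {r} {s} {b} {c} a~p p~q q~b a∥q p∥b a~r r~s s~c a∥s r∥c a∥b a∥c b∥c
        with compare p c | compare r b
      ... | equal refl   | _            = proj₂ a∥c a~p
      ... | adjacent p~c | _            = three-two a~p p~q q~b a∥q p∥b a~p p~c a∥b a∥c b∥c
      ... | apart _      | equal refl   = proj₂ a∥b a~r
      ... | apart _      | adjacent r~b = three-two a~r r~s s~c a∥s r∥c a~r r~b a∥c a∥b (∥-sym b∥c)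
      ... | apart p∥c    | apart r∥b    with compare q c | compare s b
      ...   | equal refl   | _            = proj₂ b∥c (~-sym q~b)
      ...   | adjacent q~c | _            = noClaw (mkClaw (~-sym p~q) q~b q~c p∥b p∥c b∥c)
      ...   | apart _      | equal refl   = proj₂ b∥c s~c
      ...   | apart _      | adjacent s~b = noClaw (mkClaw (~-sym r~s) s~b s~c r∥b r∥c b∥c)
      ...   | apart q∥c    | apart s∥b    with compare q s
      ...     | equal refl   = proj₂ s∥b q~b
      ...     | apart q∥s    = two-two a~p p~q a~r r~s a∥q a∥s q∥s
      ...     | adjacent q~s with compare p s
      ...       | equal refl   = proj₂ p∥c s~c
      ...       | adjacent p~s =
        noBull (mkBull q~s (~-sym p~s) (~-sym p~q) q~b s~c q∥c s∥b p∥b p∥c b∥c)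
      ...       | apart p∥s    = noP₅ (mkP₅ a~p p~q q~s s~c a∥q a∥s a∥c p∥s p∥c q∥c)

      noIndependentTriple : Connected G → NoIndependentTriple
      noIndependentTriple conn {a} {b} {c} a∥b a∥c b∥c
        with connected⇒near conn a b | connected⇒near conn a c
      ... | self    | _       = proj₁ a∥b refl
      ... | one a~b | _       = proj₂ a∥b a~b
      ... | two _ _ _ | self  = proj₁ a∥c refl
      ... | three _ _ _ _ _ _ | self = proj₁ a∥c refl
      ... | two _ _ _ | one a~c = proj₂ a∥c a~c
      ... | three _ _ _ _ _ _ | one a~c = proj₂ a∥c a~c
      ... | two a~p p~b _ | two a~q q~c _ = two-two a~p p~b a~q q~c a∥b a∥c b∥c
      ... | three a~p p~q q~b a∥q _ p∥b | two a~r r~c _ =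
        three-two a~p p~q q~b a∥q p∥b a~r r~c a∥b a∥c b∥c
      ... | two a~r r~b _ | three a~p p~q q~c a∥q _ p∥c =
        three-two a~p p~q q~c a∥q p∥c a~r r~b a∥c a∥b (∥-sym b∥c)
      ... | three a~p p~q q~b a∥q _ p∥b | three a~r r~s s~c a∥s _ r∥c =
        three-three a~p p~q q~b a∥q p∥b a~r r~s s~c a∥s r∥c a∥b a∥c b∥c

  -- From the absence of independent triples to a co-chain partition

  closedNbhd? : ∀ v → Decidable (closedNbhd G v)
  closedNbhd? v u = (u ≟ v) ⊎-dec adj? G v u

  N[_] : Fin n → Subset n
  N[ v ] = fromDec (closedNbhd? v)

  -- One more than the usual degree. The order of vertices is the same, and inclusions of closed
  -- neighbourhoods bound it directly.
  deg : Fin n → ℕ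
  deg v = ∣ N[ v ] ∣

  ∉closedNbhd⇒∥ : ∀ {u v} → ¬ closedNbhd G v u → v ∥ u
  ∉closedNbhd⇒∥ u∉ = u∉ ∘ inj₁ ∘ sym , u∉ ∘ inj₂

  ∥⇒∉closedNbhd : ∀ {u v} → v ∥ u → ¬ closedNbhd G v u
  ∥⇒∉closedNbhd (v≢u , _) (inj₁ u≡v) = v≢u (sym u≡v)
  ∥⇒∉closedNbhd (_ , v≁u) (inj₂ v~u) = v≁u v~u

  closedNbhd-strict : ∀ {u v s} → closedNbhd G v ⊆ closedNbhd G u →
    closedNbhd G u s → v ∥ s → deg v ℕ.< deg u
  closedNbhd-strict {u} {v} {s} N[v]⊆N[u] s∈N[u] v∥s = p⊂q⇒∣p∣<∣q∣
    ( ∈-fromDec⁺ (closedNbhd? u) ∘ N[v]⊆N[u] ∘ ∈-fromDec⁻ (closedNbhd? v)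
    , s , ∈-fromDec⁺ (closedNbhd? u) s∈N[u] , ∥⇒∉closedNbhd v∥s ∘ ∈-fromDec⁻ (closedNbhd? v))

  module _ (noC₄ : ¬ C 4 IsInducedIn G) where

    -- Suppose `s` lies in the neighbourhood of `u` but not of `v`. A vertex `t` in that of `v` but
    -- not of `u` would, like `s`, lie outside `X`, so `s ~ t` and `u s t v` is an induced C₄. Hence
    -- the neighbourhood of `v` is properly contained in that of `u`, against `deg≤`.
    deg≤⇒closedNbhd⊆ : ∀ {X} → IsClique G X → IsClique G (∁ X) →
      ∀ {u v} → u ∈ X → v ∈ X → deg u ℕ.≤ deg v → closedNbhd G u ⊆ closedNbhd G v
    deg≤⇒closedNbhd⊆ {X} clique-X clique-∁X {u} {v} u∈X v∈X deg≤ {s} s∈N[u] =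
      decidable-stable (closedNbhd? v s) λ s∉N[v] →
        let v∥s = ∉closedNbhd⇒∥ s∉N[v]
        in ℕ.<⇒≱ (closedNbhd-strict (N[v]⊆N[u] v∥s) s∈N[u] v∥s) deg≤
      where
      ∥⇒∉X : ∀ {x y} → x ∈ X → x ∥ y → y ∈ ∁ X
      ∥⇒∉X x∈X (x≢y , x≁y) = x∉p⇒x∈∁p λ y∈X → x≁y (clique-X x∈X y∈X x≢y)

      N[v]⊆N[u] : v ∥ s → closedNbhd G v ⊆ closedNbhd G u
      N[v]⊆N[u] v∥s {t} t∈N[v] = decidable-stable (closedNbhd? u t) λ t∉N[u] →
        square (∉closedNbhd⇒∥ t∉N[u]) s∈N[u] t∈N[v]
        where
        square : u ∥ t → closedNbhd G u s → closedNbhd G v t → ⊥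
        -- If `s` is `u` or `t` is `v`, then `u` and `v` would be non-adjacent within the clique
        -- `X`.
        square u∥t (inj₁ refl) _           = proj₂ v∥s (clique-X v∈X u∈X (proj₁ v∥s))
        square u∥t (inj₂ _)    (inj₁ refl) = proj₂ u∥t (clique-X u∈X v∈X (proj₁ u∥t))
        square u∥t (inj₂ u~s)  (inj₂ v~t)  = noC₄ (mkC₄ u~s s~t (~-sym v~t) v~u u∥t (∥-sym v∥s))
          where
          s~t = clique-∁X (∥⇒∉X v∈X v∥s) (∥⇒∉X u∈X u∥t) λ { refl → proj₂ u∥t u~s }
          v~u = clique-X v∈X u∈X λ { refl → ∥⇒∉closedNbhd v∥s (inj₂ u~s) }

    module _ (noC₅ : ¬ C 5 IsInducedIn G) (noTriple : NoIndependentTriple) where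

      nonNbhd-clique : ∀ a → IsClique G (∁ N[ a ])
      nonNbhd-clique a {u} {v} u∈ v∈ u≢v = decidable-stable (adj? G u v) λ u≁v →
        noTriple (∉N u∈) (∉N v∈) (u≢v , u≁v)
        where
        ∉N : ∀ {w} → w ∈ ∁ N[ a ] → a ∥ w
        ∉N w∈ = ∉closedNbhd⇒∥ (x∈∁p⇒x∉p w∈ ∘ ∈-fromDec⁺ (closedNbhd? a))

      module _ {a} (minimal : ∀ v → deg a ℕ.≤ deg v) where

        -- Otherwise the closed neighbourhood of `u` lies inside that of `a` and misses `v`, so `u`
        -- has smaller degree than `a`.
        escape : ∀ {u v} → a ~ u → a ~ v → u ∥ v → ∃ λ w → a ∥ w × u ~ w
        escape {u} {v} a~u a~v u∥v with any? (λ w → ¬? (closedNbhd? a w) ×-dec adj? G u w)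
        ... | yes (w , w∉N[a] , u~w) = w , ∉closedNbhd⇒∥ w∉N[a] , u~w
        ... | no  none = contradiction (minimal u) (ℕ.<⇒≱ (closedNbhd-strict N[u]⊆N[a] (inj₂ a~v) u∥v))
          where
          N[u]⊆N[a] : closedNbhd G u ⊆ closedNbhd G a
          N[u]⊆N[a] (inj₁ refl)    = inj₂ a~u
          N[u]⊆N[a] {w} (inj₂ u~w) = decidable-stable (closedNbhd? a w) λ w∉N[a] → none (w , w∉N[a] , u~w)

        -- If `w` or `w′` is adjacent to both `u` and `v`, it closes a C₄ with `a`. Otherwise `w`
        -- and `w′` are distinct, and adjacent because `a`, `w`, `w′` is no independent triple, so
        -- `a u w w′ v` is an induced C₅.
        minDeg-simplicial : ∀ {u v} → a ~ u → a ~ v → ¬ u ∥ v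
        minDeg-simplicial {u} {v} a~u a~v u∥v
          with escape a~u a~v u∥v | escape a~v a~u (∥-sym u∥v)
        ... | w , a∥w , u~w | w′ , a∥w′ , v~w′ with compare v w | compare u w′
        ...   | equal refl   | _             = proj₂ a∥w a~v
        ...   | adjacent v~w | _             = noC₄ (mkC₄ a~u u~w (~-sym v~w) (~-sym a~v) a∥w u∥v)
        ...   | apart _      | equal refl    = proj₂ a∥w′ a~u
        ...   | apart _      | adjacent u~w′ = noC₄ (mkC₄ a~u u~w′ (~-sym v~w′) (~-sym a~v) a∥w′ u∥v)
        ...   | apart v∥w    | apart u∥w′    with compare w w′
        ...     | equal refl    = proj₂ u∥w′ u~w
        ...     | apart w∥w′    = noTriple a∥w a∥w′ w∥w′
        ...     | adjacent w~w′ =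
          noC₅ (mkC₅ a~u u~w w~w′ (~-sym v~w′) (~-sym a~v) a∥w a∥w′ u∥w′ u∥v (∥-sym v∥w))

        nbhd-clique : IsClique G N[ a ]
        nbhd-clique {u} {v} u∈ v∈ u≢v with ∈-fromDec⁻ (closedNbhd? a) u∈ | ∈-fromDec⁻ (closedNbhd? a) v∈
        ... | inj₁ refl | inj₁ refl = contradiction refl u≢v
        ... | inj₁ refl | inj₂ a~v  = a~v
        ... | inj₂ a~u  | inj₁ refl = ~-sym a~u
        ... | inj₂ a~u  | inj₂ a~v  = decidable-stable (adj? G u v) λ u≁v →
          minDeg-simplicial a~u a~v (u≢v , u≁v)

        minDeg⇒coChain : IsCoChain G
        minDeg⇒coChain with sortedEnumeration deg N[ a ]
        ... | x , x∈X , x-inj , x-onto , x-mono = record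
          { X        = N[ a ]
          ; Y        = ∁ N[ a ]
          ; cover    = cover
          ; disjoint = x∈p⇒x∉∁p
          ; clique-X = nbhd-clique
          ; clique-Y = nonNbhd-clique a
          ; x        = x
          ; x∈X      = x∈X
          ; x-inj    = x-inj
          ; x-onto   = x-onto
          ; nested   = λ {i} {j} i<j →
              deg≤⇒closedNbhd⊆ nbhd-clique (nonNbhd-clique a) (x∈X i) (x∈X j) (x-mono i<j)
          }
          where
          cover : ∀ v → v ∈ N[ a ] ⊎ v ∈ ∁ N[ a ]
          cover v with v ∈? N[ a ]
          ... | yes v∈ = inj₁ v∈
          ... | no  v∉ = inj₂ (x∉p⇒x∈∁p v∉)

  -- Co-chain graphs contain none of the five graphs

  module _ (cochain : IsCoChain G) where
    open IsCoChain cochain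

    coChain⇒noTriple : NoIndependentTriple
    coChain⇒noTriple {a} {b} {c} (a≢b , a≁b) (a≢c , a≁c) (b≢c , b≁c) with cover a | cover b | cover c
    ... | inj₁ a∈ | inj₁ b∈ | _       = a≁b (clique-X a∈ b∈ a≢b)
    ... | inj₁ a∈ | inj₂ _  | inj₁ c∈ = a≁c (clique-X a∈ c∈ a≢c)
    ... | inj₁ _  | inj₂ b∈ | inj₂ c∈ = b≁c (clique-Y b∈ c∈ b≢c)
    ... | inj₂ a∈ | inj₂ b∈ | _       = a≁b (clique-Y a∈ b∈ a≢b)
    ... | inj₂ a∈ | inj₁ _  | inj₂ c∈ = a≁c (clique-Y a∈ c∈ a≢c)
    ... | inj₂ _  | inj₁ b∈ | inj₁ c∈ = b≁c (clique-X b∈ c∈ b≢c)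

    ∥∈X⇒∈Y : ∀ {u v} → u ∥ v → u ∈ X → v ∈ Y
    ∥∈X⇒∈Y {u} {v} (u≢v , u≁v) u∈X with cover v
    ... | inj₁ v∈X = contradiction (clique-X u∈X v∈X u≢v) u≁v
    ... | inj₂ v∈Y = v∈Y

    ∥∈Y⇒∈X : ∀ {u v} → u ∥ v → u ∈ Y → v ∈ X
    ∥∈Y⇒∈X {u} {v} (u≢v , u≁v) u∈Y with cover v
    ... | inj₁ v∈X = v∈X
    ... | inj₂ v∈Y = contradiction (clique-Y u∈Y v∈Y u≢v) u≁v

    X-comparable : ∀ {u v} → u ∈ X → v ∈ X →
      closedNbhd G u ⊆ closedNbhd G v ⊎ closedNbhd G v ⊆ closedNbhd G u
    X-comparable u∈X v∈X with x-onto u∈X | x-onto v∈X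
    ... | i , refl | j , refl with <-cmp i j
    ...   | tri< i<j _ _  = inj₁ (nested i<j)
    ...   | tri≈ _ refl _ = inj₁ λ w∈ → w∈
    ...   | tri> _ _ j<i  = inj₂ (nested j<i)

    -- The private neighbours u′ of v and v′ of u make the neighbourhoods of u and v incomparable.
    X-noSquare : ∀ {u v u′ v′} → u ∈ X → v ∈ X → u ~ v′ → v ~ u′ → u ∥ u′ → v ∥ v′ → ⊥
    X-noSquare u∈X v∈X u~v′ v~u′ u∥u′ v∥v′ with X-comparable u∈X v∈X
    ... | inj₁ N[u]⊆N[v] = ∥⇒∉closedNbhd v∥v′ (N[u]⊆N[v] (inj₂ u~v′))
    ... | inj₂ N[v]⊆N[u] = ∥⇒∉closedNbhd u∥u′ (N[v]⊆N[u] (inj₂ v~u′))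

    coChain⇒noP₅ : ¬ P 5 IsInducedIn G
    coChain⇒noP₅ h = coChain⇒noTriple
      (nonEdge (P 5) h (# 0) (# 2)) (nonEdge (P 5) h (# 0) (# 4)) (nonEdge (P 5) h (# 2) (# 4))

    coChain⇒noClaw : ¬ claw IsInducedIn G
    coChain⇒noClaw h = coChain⇒noTriple
      (nonEdge claw h (# 1) (# 2)) (nonEdge claw h (# 1) (# 3)) (nonEdge claw h (# 2) (# 3))

    coChain⇒noBull : ¬ bull IsInducedIn G
    coChain⇒noBull h = coChain⇒noTriple
      -- The independent triple consists of the two pendant vertices and the triangle vertex without
      -- a pendant.
      (nonEdge bull h (# 2) (# 3)) (nonEdge bull h (# 2) (# 4)) (nonEdge bull h (# 3) (# 4))

    -- The non-edges of C₅ form the odd closed walk 0 2 4 1 3 0, along which membership in X and Y alternates.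
    coChain⇒noC₅ : ¬ C 5 IsInducedIn G
    coChain⇒noC₅ h@(f , _) with cover (f (# 0))
    ... | inj₁ 0∈X = disjoint 0∈X
      (∥∈X⇒∈Y (ne (# 3) (# 0)) (∥∈Y⇒∈X (ne (# 1) (# 3)) (∥∈X⇒∈Y (ne (# 4) (# 1))
        (∥∈Y⇒∈X (ne (# 2) (# 4)) (∥∈X⇒∈Y (ne (# 0) (# 2)) 0∈X)))))
      where ne = nonEdge (C 5) h
    ... | inj₂ 0∈Y = disjoint
      (∥∈Y⇒∈X (ne (# 3) (# 0)) (∥∈X⇒∈Y (ne (# 1) (# 3)) (∥∈Y⇒∈X (ne (# 4) (# 1))
        (∥∈X⇒∈Y (ne (# 2) (# 4)) (∥∈Y⇒∈X (ne (# 0) (# 2)) 0∈Y))))) 0∈Y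
      where ne = nonEdge (C 5) h

    -- Each diagonal of the cycle is a non-edge, so it has an end in `X`. Two such ends, one from
    -- each diagonal, are consecutive on the cycle, and each is adjacent to the vertex opposite the
    -- other, as `X-noSquare` forbids.
    coChain⇒noC₄ : ¬ C 4 IsInducedIn G
    coChain⇒noC₄ h@(f , _) with cover (f (# 0)) | cover (f (# 1))
    ... | inj₁ 0∈X | inj₁ 1∈X =
      X-noSquare 0∈X 1∈X (edge (C 4) h (# 0) (# 3)) (edge (C 4) h (# 1) (# 2))
        (nonEdge (C 4) h (# 0) (# 2)) (nonEdge (C 4) h (# 1) (# 3))
    ... | inj₁ 0∈X | inj₂ 1∈Y =
      X-noSquare 0∈X (∥∈Y⇒∈X (nonEdge (C 4) h (# 1) (# 3)) 1∈Y)
        (edge (C 4) h (# 0) (# 1)) (edge (C 4) h (# 3) (# 2))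
        (nonEdge (C 4) h (# 0) (# 2)) (nonEdge (C 4) h (# 3) (# 1))
    ... | inj₂ 0∈Y | inj₁ 1∈X =
      X-noSquare (∥∈Y⇒∈X (nonEdge (C 4) h (# 0) (# 2)) 0∈Y) 1∈X
        (edge (C 4) h (# 2) (# 3)) (edge (C 4) h (# 1) (# 0))
        (nonEdge (C 4) h (# 2) (# 0)) (nonEdge (C 4) h (# 1) (# 3))
    ... | inj₂ 0∈Y | inj₂ 1∈Y =
      X-noSquare (∥∈Y⇒∈X (nonEdge (C 4) h (# 0) (# 2)) 0∈Y) (∥∈Y⇒∈X (nonEdge (C 4) h (# 1) (# 3)) 1∈Y)
        (edge (C 4) h (# 2) (# 1)) (edge (C 4) h (# 3) (# 0))
        (nonEdge (C 4) h (# 2) (# 0)) (nonEdge (C 4) h (# 3) (# 1))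

-- Choice of a minimum-degree vertex and the equivalence

∃-minimal : ∀ {n} (f : Fin (suc n) → ℕ) → ∃ λ a → ∀ v → f a ℕ.≤ f v
∃-minimal f = Extrema.argmin f zero (allFin _) ,
  λ v → All.lookup (Extrema.f[argmin]≤f[xs] {f = f} zero (allFin _)) (∈-allFin v)

noTriple⇒coChain : ∀ {n} (G : Graph n) → ¬ C 4 IsInducedIn G → ¬ C 5 IsInducedIn G →
  NoIndependentTriple G → IsCoChain G
-- The empty graph has no vertex of minimum degree, so two empty cliques are given directly.
noTriple⇒coChain {zero} G _ _ _ = record
  { X = [] ; Y = [] ; cover = λ () ; disjoint = λ () ; clique-X = λ () ; clique-Y = λ ()
  ; x = λ () ; x∈X = λ () ; x-inj = λ { {()} } ; x-onto = λ () ; nested = λ { {()} } }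
noTriple⇒coChain {suc n} G noC₄ noC₅ noTriple = fromMinimal (∃-minimal (deg G))
  where
  fromMinimal : (∃ λ a → ∀ v → deg G a ℕ.≤ deg G v) → IsCoChain G
  fromMinimal (a , minimal) = minDeg⇒coChain G noC₄ noC₅ noTriple {a} minimal

theorem16 : ∀ (n : ℕ) (G : Graph n) → Connected G →
    (¬ (P 5 IsInducedIn G) × ¬ (C 4 IsInducedIn G) × ¬ (C 5 IsInducedIn G) × ¬ (claw IsInducedIn G) × ¬ (bull IsInducedIn G)) ⇔ IsCoChain G
theorem16 n G conn = mk⇔
  (λ (noP₅ , noC₄ , noC₅ , noClaw , noBull) →
    noTriple⇒coChain G noC₄ noC₅ (noIndependentTriple G noP₅ noC₄ noC₅ noClaw noBull conn))
  (λ cc → coChain⇒noP₅ G cc , coChain⇒noC₄ G cc , coChain⇒noC₅ G cc , coChain⇒noClaw G cc , coChain⇒noBull G cc)
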